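{- For every integer $n\ge 2$, there are, up to isomorphism, exactly $2^{n-2}$ commutative idempotent residuated chains with $n$ elements.
   Context: A residuated lattice is an algebra $\mathbf A=\langle A,\wedge,\vee,\cdot,\backslash,/,\mathrm e\rangle$ such that $\langle A,\wedge,\vee\rangle$ is a lattice, $\langle A,\cdot,\mathrm e\rangle$ is a monoid, and for all $a,b,c\in A$: $b\le a\backslash c\iff a\cdot b\le c\iff a\le c/b$. It is commutative if $ab=ba$ for all $a,b\in A$, idempotent if $aa=a$ for all $a\in A$, and a residuated chain if its lattice order is total. No relation between $\mathrm e$ and the greatest element of the lattice is assumed. -}

module Defs where

open import Algebra.Core using (Op₂)
open import Algebra.Bundles.Raw using (RawMonoid)
import Algebra.Definitions
open import Algebra.Lattice.Bundles using (Lattice; RawLattice)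
open import Algebra.Lattice.Morphism.Structures using (module LatticeMorphisms)
open import Algebra.Lattice.Structures using (IsLattice)
import Algebra.Lattice.Properties.Lattice as LatticeProperties
import Algebra.Morphism.Definitions as MorphismDefinitions
open import Algebra.Morphism.Structures using (module MonoidMorphisms)
open import Algebra.Structures using (IsMonoid)
open import Data.Fin using (Fin)
open import Data.Nat using (ℕ)
open import Data.Product using (Σ-syntax)
open import Function.Bundles using (_⇔_)
open import Function.Definitions using (Bijective)
open import Level using (Level; _⊔_; suc)
open import Relation.Binary.Bundles using (Poset)
open import Relation.Binary.Core using (Rel)
open import Relation.Binary.Definitions using (Total)
open import Relation.Binary.PropositionalEquality using (_≡_)

-- "A has exactly k elements up to R", for an equivalence relation R: a list
-- of k elements, pairwise unrelated by R, to one of which every element of A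
-- is related.
HasExactly : ∀ {a r} {A : Set a} → ℕ → Rel A r → Set (a ⊔ r)
HasExactly {A = A} k R = Σ[ f ∈ (Fin k → A) ] Bijective _≡_ R f

-- Congruence of _\\_ and _//_ with respect to _≈_ is not a field because it
-- follows from the residuation laws and antisymmetry of _≤_.
record ResiduatedLattice (c ℓ : Level) : Set (suc (c ⊔ ℓ)) where
  infix  4 _≈_
  infixr 6 _∨_
  infixr 7 _∧_
  infixl 8 _∙_ _\\_ _//_
  field
    Carrier   : Set c
    _≈_       : Rel Carrier ℓ
    _∧_       : Op₂ Carrier
    _∨_       : Op₂ Carrier
    _∙_       : Op₂ Carrier
    _\\_      : Op₂ Carrier
    _//_      : Op₂ Carrier
    e         : Carrier
    isLattice : IsLattice _≈_ _∨_ _∧_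
    isMonoid  : IsMonoid _≈_ _∙_ e

  lattice : Lattice c ℓ
  lattice = record { isLattice = isLattice }

  -- The lattice order: x ≤ y unfolds to x ≈ x ∧ y.
  open Poset (LatticeProperties.poset lattice) public using (_≤_)

  field
    \\-residual : ∀ a b c → b ≤ a \\ c ⇔ a ∙ b ≤ c
    //-residual : ∀ a b c → a ∙ b ≤ c ⇔ a ≤ c // b

  rawLattice : RawLattice c ℓ
  rawLattice = record { _≈_ = _≈_ ; _∧_ = _∧_ ; _∨_ = _∨_ }

  rawMonoid : RawMonoid c ℓ
  rawMonoid = record { _≈_ = _≈_ ; _∙_ = _∙_ ; ε = e }

module _ {c ℓ} (A B : ResiduatedLattice c ℓ) where
  private
    module A = ResiduatedLattice A
    module B = ResiduatedLattice B
  open LatticeMorphisms A.rawLattice B.rawLattice using (IsLatticeIsomorphism)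
  open MonoidMorphisms A.rawMonoid B.rawMonoid using (IsMonoidHomomorphism)
  open MorphismDefinitions A.Carrier B.Carrier B._≈_ using (Homomorphic₂)

  -- Bijectivity is part of IsLatticeIsomorphism.
  record Isomorphism : Set (c ⊔ ℓ) where
    field
      ⟦_⟧                  : A.Carrier → B.Carrier
      isLatticeIsomorphism : IsLatticeIsomorphism ⟦_⟧
      isMonoidHomomorphism : IsMonoidHomomorphism ⟦_⟧
      \\-homo              : Homomorphic₂ ⟦_⟧ A._\\_ B._\\_
      //-homo              : Homomorphic₂ ⟦_⟧ A._//_ B._//_

record CommutativeIdempotentResiduatedChain (c ℓ : Level) (n : ℕ)
       : Set (suc (c ⊔ ℓ)) where
  field
    residuatedLattice : ResiduatedLattice c ℓ

  open ResiduatedLattice residuatedLattice public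
  open Algebra.Definitions _≈_ using (Commutative; Idempotent)

  field
    ∙-comm  : Commutative _∙_
    ∙-idem  : Idempotent _∙_
    ≤-total : Total _≤_
    size    : HasExactly n _≈_

-- Isomorphism ignores the chosen enumeration in the field size.
infix 4 _≅_
_≅_ : ∀ {c ℓ n} → Rel (CommutativeIdempotentResiduatedChain c ℓ n) (c ⊔ ℓ)
A ≅ B = Isomorphism (residuatedLattice A) (residuatedLattice B)
  where open CommutativeIdempotentResiduatedChain

{-# OPTIONS --safe #-}

-- In a commutative idempotent residuated chain x ∙ y is always x or y, so ∙ is
-- the maximum for a second total order, which starts at e and ends at an
-- absorbing element. Elements above e are multiplied by lattice join and elements
-- below e by lattice meet, hence the chain is determined by the word recording, for
-- the elements in the order of ∙, whether they lie below or above e. By residuation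
-- an absorbing element is the lattice minimum, so the last sign is forced; the
-- n - 2 signs in between are arbitrary, because placing the i-th element at ± i
-- in ℤ always yields such a chain.
module Submission where

open import Defs
open import Algebra.Definitions using (Selective)
open import Algebra.Lattice.Bundles using (module Lattice)
open import Algebra.Lattice.Structures using (IsSemilattice)
open import Algebra.Lattice.Morphism.Structures using (module LatticeMorphisms)
open import Algebra.Morphism.Structures using (module MonoidMorphisms)
open import Algebra.Structures using (module IsMonoid)
open import Algebra.Morphism.Definitions using (Homomorphic₂)
open import Data.Fin as Fin using (Fin; zero; suc; toℕ; fromℕ; inject₁; punchIn; punchOut; funToFin; finToFun)
open import Data.Fin.Induction using (<-weakInduction; >-weakInduction)
open import Data.Fin.Patterns using (0F; 1F)
import Data.Fin.Properties as Fin
open import Data.Integer as ℤ using (ℤ; +_; -_; -[1+_]; ∣_∣; 0ℤ)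
import Data.Integer.Properties as ℤ
open import Data.List using (List; allFin; filter)
open import Data.List.Extrema using (argmin; argmax; f[argmin]≤f[xs]; f[xs]≤f[argmax]; argmax-all)
open import Data.List.Membership.Propositional.Properties using (∈-allFin; ∈-filter⁺)
import Data.List.Relation.Unary.All as All
open import Data.List.Relation.Unary.All.Properties using (all-filter)
open import Data.Nat as ℕ using (ℕ; _≤_; _∸_; _^_; z≤n; s≤s; s≤s⁻¹)
import Data.Nat.Properties as ℕ
open import Data.Product using (_×_; _,_; proj₁; proj₂; ∃-syntax)
open import Data.Sum using (_⊎_; inj₁; inj₂; [_,_]′; map; swap)
open import Data.Vec.Functional using (insertAt)
open import Data.Vec.Functional.Properties using (insertAt-lookup; insertAt-punchIn)
open import Function using (_∘_; _on_)
open import Function.Bundles using (_⇔_; mk⇔; module Equivalence)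
open import Function.Definitions using (Injective; StrictlySurjective)
open import Level using (Level; Lift; lift; lower; 0ℓ)
open import Relation.Binary.Bundles using (TotalOrder)
import Relation.Binary.Construct.Flip.EqAndOrd as Flip
import Relation.Binary.Construct.NaturalOrder.Right as NaturalOrder
open import Relation.Binary.Core using (Rel)
open import Relation.Binary.Lattice using () renaming (Lattice to OrderLattice)
open import Relation.Binary.PropositionalEquality
  using (_≡_; _≗_; refl; sym; trans; cong; cong₂; subst; subst₂; isEquivalence; module ≡-Reasoning)
open import Relation.Binary.Structures using (IsTotalOrder)
open import Relation.Nullary using (yes; no; contradiction)
open import Algebra.Construct.NaturalChoice.Base using (module MaxOperator)
import Algebra.Construct.NaturalChoice.Max as Max
import Algebra.Construct.NaturalChoice.Min as Min
import Algebra.Lattice.Construct.NaturalChoice.MinMaxOp as MinMax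
import Algebra.Lattice.Properties.Lattice as LatticeProperties
import Relation.Binary.Reasoning.PartialOrder as PosetReasoning
import Relation.Binary.Reasoning.Setoid as SetoidReasoning

open Equivalence using (to; from)

-- Finite total orders: rigidity and sorting.

-- Every step of `f` rises by at least one, so induction upwards from `zero` gives `i ≤ f i` and
-- induction downwards from the last element gives `f i ≤ i`. This rigidity later shows that
-- isomorphic word chains have the same word.
strictlyMonotone⇒id : ∀ {n} (f : Fin n → Fin n) →
                      (∀ {i j} → i Fin.< j → f i Fin.< f j) → ∀ i → f i ≡ i
strictlyMonotone⇒id {ℕ.suc n} f mono i = Fin.≤-antisym (below i) (above i)
  where
  open ℕ.≤-Reasoning

  inject₁<suc : ∀ (i : Fin n) → inject₁ i Fin.< suc i
  inject₁<suc i = s≤s (ℕ.≤-reflexive (Fin.toℕ-inject₁ i))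

  above : ∀ i → i Fin.≤ f i
  above = <-weakInduction (λ i → i Fin.≤ f i) z≤n λ i i≤fi → begin-strict
    toℕ i               ≡⟨ Fin.toℕ-inject₁ i ⟨
    toℕ (inject₁ i)     ≤⟨ i≤fi ⟩
    toℕ (f (inject₁ i)) <⟨ mono (inject₁<suc i) ⟩
    toℕ (f (suc i))     ∎

  below : ∀ i → f i Fin.≤ i
  below = >-weakInduction (λ i → f i Fin.≤ i) (Fin.≤fromℕ _) λ i fi≤i → s≤s⁻¹ (begin-strict
    toℕ (f (inject₁ i))     <⟨ mono (inject₁<suc i) ⟩
    toℕ (f (suc i))         ≤⟨ fi≤i ⟩
    ℕ.suc (toℕ i)           ≡⟨ cong ℕ.suc (Fin.toℕ-inject₁ i) ⟨
    ℕ.suc (toℕ (inject₁ i)) ∎)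

module _ {a ℓ₁ ℓ₂} (T : TotalOrder a ℓ₁ ℓ₂) where
  open TotalOrder T using (Carrier) renaming (_≤_ to _≲_)

  -- Selection sort: a minimum is put first and `punchIn i₀` embeds the sorted remainder. The result
  -- is a permutation of the indices, so that injectivity and surjectivity of `f` pass to `f ∘ π`.
  sort : ∀ {n} (f : Fin n → Carrier) →
         ∃[ π ] Injective _≡_ _≡_ π × StrictlySurjective _≡_ π ×
                ((i j : Fin n) → i Fin.≤ j → f (π i) ≲ f (π j))
  sort {ℕ.zero}  f = (λ ()) , (λ { {()} }) , (λ ()) , λ ()
  sort {ℕ.suc n} f = π , π-injective , π-surjective , π-monotone
    where
    i₀ : Fin (ℕ.suc n)
    i₀ = argmin T f zero (allFin _)

    rest = sort (f ∘ punchIn i₀)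
    π′ = proj₁ rest

    π : Fin (ℕ.suc n) → Fin (ℕ.suc n)
    π zero    = i₀
    π (suc i) = punchIn i₀ (π′ i)

    π-injective : Injective _≡_ _≡_ π
    π-injective {zero}  {zero}  _  = refl
    π-injective {zero}  {suc j} eq = contradiction (sym eq) (Fin.punchInᵢ≢i i₀ _)
    π-injective {suc i} {zero}  eq = contradiction eq (Fin.punchInᵢ≢i i₀ _)
    π-injective {suc i} {suc j} eq =
      cong suc (proj₁ (proj₂ rest) (Fin.punchIn-injective i₀ _ _ eq))

    π-surjective : StrictlySurjective _≡_ π
    π-surjective y with i₀ Fin.≟ y
    ... | yes i₀≡y = zero , i₀≡y
    ... | no  i₀≢y with proj₁ (proj₂ (proj₂ rest)) (punchOut i₀≢y)
    ...   | x , eq = suc x , trans (cong (punchIn i₀) eq) (Fin.punchIn-punchOut i₀≢y)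

    π-monotone : ∀ i j → i Fin.≤ j → f (π i) ≲ f (π j)
    π-monotone zero    j       _         = All.lookup
      (f[argmin]≤f[xs] T {f = f} zero (allFin _)) (∈-allFin (π j))
    π-monotone (suc i) (suc j) (s≤s i≤j) = proj₂ (proj₂ (proj₂ rest)) i j i≤j

-- Isomorphisms of residuated lattices in terms of order, product and unit.

module _ {c ℓ} (A B : ResiduatedLattice c ℓ) where
  private
    module A where
      open ResiduatedLattice A public
      open OrderLattice (LatticeProperties.∨-∧-orderTheoreticLattice lattice) public
        hiding (Carrier; _≈_; _≤_; _∧_; _∨_)
    module B where
      open ResiduatedLattice B public
      open OrderLattice (LatticeProperties.∨-∧-orderTheoreticLattice lattice) public
        hiding (Carrier; _≈_; _≤_; _∧_; _∨_)

  -- Meets, joins and both residuals have universal properties stated by the order and the product.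
  -- Since `f` is surjective, an element of `B` is determined by the values of `f` below it
  -- (`≈-below`) or above it (`≈-above`), so preservation of these operations reduces to comparing
  -- such values.
  orderIsomorphism : (f : A.Carrier → B.Carrier) →
                     (∀ {x y} → x A.≤ y ⇔ f x B.≤ f y) →
                     (∀ y → ∃[ x ] f x B.≈ y) →
                     Homomorphic₂ A.Carrier B.Carrier B._≈_ f A._∙_ B._∙_ →
                     f A.e B.≈ B.e → Isomorphism A B
  orderIsomorphism f order surj ∙-homo e-homo = record
    { ⟦_⟧ = f
    ; isLatticeIsomorphism = record
      { isLatticeMonomorphism = record
        { isLatticeHomomorphism = record
          { isRelHomomorphism = isRelHomomorphism
          ; ∧-homo = λ x y → ≈-below λ z → mk⇔
              (λ p → let q = from order p in
                B.∧-greatest (to order (A.trans q (A.x∧y≤x x y)))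
                             (to order (A.trans q (A.x∧y≤y x y))))
              (λ p → to order (A.∧-greatest (from order (B.trans p (B.x∧y≤x _ _)))
                                            (from order (B.trans p (B.x∧y≤y _ _)))))
          ; ∨-homo = λ x y → ≈-above λ z → mk⇔
              (λ p → let q = from order p in
                B.∨-least (to order (A.trans (A.x≤x∨y x y) q))
                          (to order (A.trans (A.y≤x∨y x y) q)))
              (λ p → to order (A.∨-least (from order (B.trans (B.x≤x∨y _ _) p))
                                         (from order (B.trans (B.y≤x∨y _ _) p))))
          }
        ; injective = λ eq → A.antisym (from order (B.reflexive eq))
                                       (from order (B.reflexive (B.Eq.sym eq)))
        }
      ; surjective = λ y → let x , fx≈y = surj y in x , λ z≈x → B.Eq.trans (f-cong z≈x) fx≈y
      }
    ; isMonoidHomomorphism = record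
      { isMagmaHomomorphism = record
        { isRelHomomorphism = isRelHomomorphism ; homo = ∙-homo }
      ; ε-homo = e-homo
      }
    ; \\-homo = λ x y → ≈-below λ z → mk⇔
        (λ p → from (B.\\-residual _ _ _) (respˡ (∙-homo x z)
                 (to order (to (A.\\-residual _ _ _) (from order p)))))
        (λ p → to order (from (A.\\-residual _ _ _) (from order
                 (respˡ (B.Eq.sym (∙-homo x z)) (to (B.\\-residual _ _ _) p)))))
    ; //-homo = λ x y → ≈-below λ z → mk⇔
        (λ p → to (B.//-residual _ _ _) (respˡ (∙-homo z y)
                 (to order (from (A.//-residual _ _ _) (from order p)))))
        (λ p → to order (to (A.//-residual _ _ _) (from order
                 (respˡ (B.Eq.sym (∙-homo z y)) (from (B.//-residual _ _ _) p)))))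
    }
    where
    respˡ : ∀ {x y z} → x B.≈ y → x B.≤ z → y B.≤ z
    respˡ x≈y x≤z = B.trans (B.reflexive (B.Eq.sym x≈y)) x≤z

    respʳ : ∀ {x y z} → x B.≈ y → z B.≤ x → z B.≤ y
    respʳ x≈y z≤x = B.trans z≤x (B.reflexive x≈y)

    f-cong : ∀ {x y} → x A.≈ y → f x B.≈ f y
    f-cong x≈y = B.antisym (to order (A.reflexive x≈y)) (to order (A.reflexive (A.Eq.sym x≈y)))

    isRelHomomorphism = record { cong = f-cong }

    ≈-below : ∀ {u v} → (∀ z → f z B.≤ u ⇔ f z B.≤ v) → u B.≈ v
    ≈-below {u} {v} eq with surj u | surj v
    ... | x , fx≈u | y , fy≈v = B.antisym
      (respˡ fx≈u (to (eq x) (B.reflexive fx≈u)))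
      (respˡ fy≈v (from (eq y) (B.reflexive fy≈v)))

    ≈-above : ∀ {u v} → (∀ z → u B.≤ f z ⇔ v B.≤ f z) → u B.≈ v
    ≈-above {u} {v} eq with surj u | surj v
    ... | x , fx≈u | y , fy≈v = B.antisym
      (respʳ fy≈v (from (eq y) (B.reflexive (B.Eq.sym fy≈v))))
      (respʳ fx≈u (to (eq x) (B.reflexive (B.Eq.sym fx≈u))))

  module _ (I : Isomorphism A B) where
    open Isomorphism I
    open LatticeMorphisms A.rawLattice B.rawLattice using (module IsLatticeIsomorphism)
    open IsLatticeIsomorphism isLatticeIsomorphism using (⟦⟧-cong; ∧-homo; injective)

    isomorphism-≤ : ∀ {x y} → x A.≤ y ⇔ ⟦ x ⟧ B.≤ ⟦ y ⟧
    isomorphism-≤ {x} {y} = mk⇔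
      (λ x≤y → B.Eq.trans (⟦⟧-cong x≤y) (∧-homo x y))
      (λ p → injective (B.Eq.trans p (B.Eq.sym (∧-homo x y))))

-- Absolute value and order in the integers.

∣∣-mono-nonNeg : ∀ {i j} → 0ℤ ℤ.≤ i → i ℤ.≤ j → ∣ i ∣ ≤ ∣ j ∣
∣∣-mono-nonNeg (ℤ.+≤+ _) (ℤ.+≤+ p) = p

∣∣-anti-nonPos : ∀ {i j} → j ℤ.≤ 0ℤ → i ℤ.≤ j → ∣ j ∣ ≤ ∣ i ∣
∣∣-anti-nonPos (ℤ.+≤+ z≤n) _          = z≤n
∣∣-anti-nonPos ℤ.-≤+       (ℤ.-≤- p) = s≤s p

-- A negative `i` lies below `j` whatever the absolute values are, so the sign of `j` suffices.
∣∣-cancel-nonNeg : ∀ {i j} → 0ℤ ℤ.≤ j → ∣ i ∣ ≤ ∣ j ∣ → i ℤ.≤ j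
∣∣-cancel-nonNeg {+ _}      (ℤ.+≤+ _) p = ℤ.+≤+ p
∣∣-cancel-nonNeg { -[1+ _ ]} (ℤ.+≤+ _) p = ℤ.-≤+

∣∣-cancel-nonPos : ∀ {i j} → i ℤ.≤ 0ℤ → ∣ j ∣ ≤ ∣ i ∣ → i ℤ.≤ j
∣∣-cancel-nonPos {j = + _}       i≤0         p       = ℤ.≤-trans i≤0 (ℤ.+≤+ z≤n)
∣∣-cancel-nonPos {j = -[1+ _ ]} ℤ.-≤+       (s≤s p) = ℤ.-≤- p
∣∣-cancel-nonPos {j = -[1+ _ ]} (ℤ.+≤+ z≤n) ()

-- The residuated chain of a word.

-- The theorem speaks of arbitrary levels, so carrier and equality are lifted. The order may stay at
-- level 0, because a residuated lattice derives its order from the meet.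
liftedTotalOrder : ∀ c ℓ {n} {_≲_ : Rel (Fin n) 0ℓ} → IsTotalOrder _≡_ _≲_ → TotalOrder c ℓ 0ℓ
liftedTotalOrder c ℓ {n} {_≲_} ≲-isTotalOrder = record
  { Carrier = Lift c (Fin n)
  ; _≈_     = λ x y → Lift ℓ (lower x ≡ lower y)
  ; _≤_     = _≲_ on lower
  ; isTotalOrder = record
    { isPartialOrder = record
      { isPreorder = record
        { isEquivalence = record
          { refl  = lift refl
          ; sym   = λ p → lift (sym (lower p))
          ; trans = λ p q → lift (trans (lower p) (lower q))
          }
        ; reflexive = λ p → O.reflexive (lower p)
        ; trans     = O.trans
        }
      ; antisym = λ p q → lift (O.antisym p q)
      }
    ; total = λ x y → O.total (lower x) (lower y)
    }
  }
  where module O = IsTotalOrder ≲-isTotalOrder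

-- The sign 0F stands for elements below e and 1F for elements above e.
value : Fin 2 → ℕ → ℤ
value 0F k = - (+ k)
value 1F k = + k

∣value∣ : ∀ s k → ∣ value s k ∣ ≡ k
∣value∣ 0F k = ℤ.∣-i∣≡∣i∣ (+ k)
∣value∣ 1F k = refl

-- Away from 0 the sign can be read off from the comparison with 0; at 0 both signs give the same
-- value, hence the `suc`.
value-suc-injective : ∀ {s t k} → (value s (ℕ.suc k) ℤ.≤ 0ℤ ⇔ value t (ℕ.suc k) ℤ.≤ 0ℤ) → s ≡ t
value-suc-injective {0F} {0F} eq = refl
value-suc-injective {0F} {1F} eq = contradiction (to eq ℤ.-≤+) λ { (ℤ.+≤+ ()) }
value-suc-injective {1F} {0F} eq = contradiction (from eq ℤ.-≤+) λ { (ℤ.+≤+ ()) }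
value-suc-injective {1F} {1F} eq = refl

-- Index 0 is the unit and has no sign. The word signs the indices 1 to `m`, and `insertAt` at
-- `fromℕ m` appends the forced sign `0F` of the last index.
valuation : ∀ {m} → (Fin m → Fin 2) → Fin (ℕ.suc (ℕ.suc m)) → ℤ
valuation     w zero    = 0ℤ
valuation {m} w (suc i) = value (insertAt w (fromℕ m) 0F i) (ℕ.suc (toℕ i))

∣valuation∣ : ∀ {m} (w : Fin m → Fin 2) i → ∣ valuation w i ∣ ≡ toℕ i
∣valuation∣     w zero    = refl
∣valuation∣ {m} w (suc i) = ∣value∣ (insertAt w (fromℕ m) 0F i) (ℕ.suc (toℕ i))

valuation-last≤0 : ∀ {m} (w : Fin m → Fin 2) → valuation w (fromℕ (ℕ.suc m)) ℤ.≤ 0ℤ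
valuation-last≤0 {m} w = subst (λ s → value s (ℕ.suc (toℕ (fromℕ m))) ℤ.≤ 0ℤ)
  (sym (insertAt-lookup w (fromℕ m) 0F)) ℤ.-≤+

-- Element i sits at height v i = ± i in the lattice order, and the product of two
-- elements is the one of larger index.
module WordChain (c ℓ : Level) {m} (w : Fin m → Fin 2) where

  private
    n = ℕ.suc (ℕ.suc m)

    last : Fin n
    last = fromℕ (ℕ.suc m)

    v : Fin n → ℤ
    v = valuation w

    _≼_ : Rel (Fin n) 0ℓ
    _≼_ = ℤ._≤_ on v

  v-injective : ∀ {i j} → v i ≡ v j → i ≡ j
  v-injective {i} {j} vi≡vj = Fin.toℕ-injective (begin
    toℕ i    ≡⟨ ∣valuation∣ w i ⟨
    ∣ v i ∣  ≡⟨ cong ∣_∣ vi≡vj ⟩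
    ∣ v j ∣  ≡⟨ ∣valuation∣ w j ⟩
    toℕ j    ∎)
    where open ≡-Reasoning

  ≼-isTotalOrder : IsTotalOrder _≡_ _≼_
  ≼-isTotalOrder = record
    { isPartialOrder = record
      { isPreorder = record
        { isEquivalence = isEquivalence
        ; reflexive     = ℤ.≤-reflexive ∘ cong v
        ; trans         = ℤ.≤-trans
        }
      ; antisym = λ p q → v-injective (ℤ.≤-antisym p q)
      }
    ; total = λ i j → ℤ.≤-total (v i) (v j)
    }

  ≼⇒≤-nonNeg : ∀ {i j} → 0ℤ ℤ.≤ v i → i ≼ j → i Fin.≤ j
  ≼⇒≤-nonNeg {i} {j} 0≤vi i≼j = subst₂ _≤_ (∣valuation∣ w i) (∣valuation∣ w j) (∣∣-mono-nonNeg 0≤vi i≼j)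

  ≼⇒≥-nonPos : ∀ {i j} → v j ℤ.≤ 0ℤ → i ≼ j → j Fin.≤ i
  ≼⇒≥-nonPos {i} {j} vj≤0 i≼j = subst₂ _≤_ (∣valuation∣ w j) (∣valuation∣ w i) (∣∣-anti-nonPos vj≤0 i≼j)

  ≤⇒≼-nonNeg : ∀ {i j} → 0ℤ ℤ.≤ v j → i Fin.≤ j → i ≼ j
  ≤⇒≼-nonNeg {i} {j} 0≤vj i≤j =
    ∣∣-cancel-nonNeg 0≤vj (subst₂ _≤_ (sym (∣valuation∣ w i)) (sym (∣valuation∣ w j)) i≤j)

  ≥⇒≼-nonPos : ∀ {i j} → v i ℤ.≤ 0ℤ → j Fin.≤ i → i ≼ j
  ≥⇒≼-nonPos {i} {j} vi≤0 j≤i =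
    ∣∣-cancel-nonPos vi≤0 (subst₂ _≤_ (sym (∣valuation∣ w j)) (sym (∣valuation∣ w i)) j≤i)

  private
    squeeze : ∀ {i j k : Fin n} → i Fin.≤ j → j Fin.≤ k → k Fin.≤ i → i ≡ j × j ≡ k
    squeeze i≤j j≤k k≤i = Fin.≤-antisym i≤j (ℕ.≤-trans j≤k k≤i) ,
                          Fin.≤-antisym j≤k (ℕ.≤-trans k≤i i≤j)

    -- This and its dual settle the mixed cases of `∙-monoˡ`, where the index of `k` lies between
    -- the other two. If `v i ≤ 0`, lowering the index of `i` can only move it up; if `0 ≤ v i`,
    -- then `i ≼ j` forces `i ≤ j` and all three indices coincide.
    ≼-squeezeˡ : ∀ {i j k} → i ≼ j → j Fin.≤ k → k Fin.≤ i → i ≼ k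
    ≼-squeezeˡ {i} i≼j j≤k k≤i with ℤ.≤-total (v i) 0ℤ
    ... | inj₁ vi≤0 = ≥⇒≼-nonPos vi≤0 k≤i
    ... | inj₂ 0≤vi with squeeze (≼⇒≤-nonNeg 0≤vi i≼j) j≤k k≤i
    ...   | refl , refl = ℤ.≤-refl

    ≼-squeezeʳ : ∀ {i j k} → i ≼ j → i Fin.≤ k → k Fin.≤ j → k ≼ j
    ≼-squeezeʳ {i} {j} i≼j i≤k k≤j with ℤ.≤-total (v j) 0ℤ
    ... | inj₂ 0≤vj = ≤⇒≼-nonNeg 0≤vj k≤j
    ... | inj₁ vj≤0 with squeeze i≤k k≤j (≼⇒≥-nonPos vj≤0 i≼j)
    ...   | refl , refl = ℤ.≤-refl

  indexOrder latticeOrder : TotalOrder c ℓ 0ℓ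
  indexOrder   = liftedTotalOrder c ℓ {n} Fin.≤-isTotalOrder
  latticeOrder = liftedTotalOrder c ℓ ≼-isTotalOrder

  open TotalOrder latticeOrder using (Carrier; _≈_) renaming (_≤_ to _⊑_)
  module Product = Max indexOrder
  module Meet = Min latticeOrder
  module Join = Max latticeOrder
  open MinMax Meet.minOperator Join.maxOperator using (⊔-⊓-isLattice)

  open Product using () renaming (_⊔_ to _∙_; ⊔-comm to ∙-comm)
  open Meet using (_⊓_)
  open Join using (_⊔_)

  x≤y⇒x∙y≡y : ∀ x y → lower x Fin.≤ lower y → lower (x ∙ y) ≡ lower y
  x≤y⇒x∙y≡y x y x≤y = lower (MaxOperator.x≤y⇒x⊔y≈y Product.maxOperator {x} {y} x≤y)

  x≥y⇒x∙y≡x : ∀ x y → lower y Fin.≤ lower x → lower (x ∙ y) ≡ lower x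
  x≥y⇒x∙y≡x x y y≤x = lower (MaxOperator.x≥y⇒x⊔y≈x Product.maxOperator {x} {y} y≤x)

  x∙y≡y⇒x≤y : ∀ x y → lower (x ∙ y) ≡ lower y → lower x Fin.≤ lower y
  x∙y≡y⇒x≤y x y eq = Product.x⊔y≈y⇒x≤y {x} {y} (lift eq)

  ∙-monoˡ : ∀ x y z → x ⊑ y → (x ∙ z) ⊑ (y ∙ z)
  ∙-monoˡ x y z x⊑y
    with Fin.≤-total {n} (lower x) (lower z) | Fin.≤-total {n} (lower y) (lower z)
  ... | inj₁ x≤z | inj₁ y≤z =
    subst₂ _≼_ (sym (x≤y⇒x∙y≡y x z x≤z)) (sym (x≤y⇒x∙y≡y y z y≤z)) ℤ.≤-refl
  ... | inj₁ x≤z | inj₂ z≤y =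
    subst₂ _≼_ (sym (x≤y⇒x∙y≡y x z x≤z)) (sym (x≥y⇒x∙y≡x y z z≤y)) (≼-squeezeʳ x⊑y x≤z z≤y)
  ... | inj₂ z≤x | inj₁ y≤z =
    subst₂ _≼_ (sym (x≥y⇒x∙y≡x x z z≤x)) (sym (x≤y⇒x∙y≡y y z y≤z)) (≼-squeezeˡ x⊑y y≤z z≤x)
  ... | inj₂ z≤x | inj₂ z≤y =
    subst₂ _≼_ (sym (x≥y⇒x∙y≡x x z z≤x)) (sym (x≥y⇒x∙y≡x y z z≤y)) x⊑y

  last-minimum : ∀ i → last ≼ i
  last-minimum i = ≥⇒≼-nonPos (valuation-last≤0 w) (Fin.≤fromℕ i)

  private
    candidates : Carrier → Carrier → List (Fin n)
    candidates x z = filter (λ i → v (lower (lift i ∙ x)) ℤ.≤? v (lower z)) (allFin n)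

  infixl 8 _/_
  -- The residual is found by finite search for the highest candidate. The default `last` is itself
  -- a candidate, being absorbing and the lattice minimum.
  _/_ : Carrier → Carrier → Carrier
  z / x = lift (argmax ℤ.≤-totalOrder v last (candidates x z))

  -- By monotonicity of the product the candidates form a down-set, so lying below their maximum is
  -- the same as being one of them.
  /-residual : ∀ x y z → (x ∙ y) ⊑ z ⇔ x ⊑ (z / y)
  /-residual x y z = mk⇔
    (λ p → All.lookup (f[xs]≤f[argmax] ℤ.≤-totalOrder {f = v} last (candidates y z))
             (∈-filter⁺ (λ i → v (lower (lift i ∙ y)) ℤ.≤? v (lower z)) (∈-allFin (lower x)) p))
    (λ p → ℤ.≤-trans (∙-monoˡ x (z / y) y p) z/y∙y⊑z)
    where
    last∙y⊑z : (lift last ∙ y) ⊑ z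
    last∙y⊑z = subst (_≼ lower z) (sym (x≥y⇒x∙y≡x (lift last) y (Fin.≤fromℕ (lower y))))
                 (last-minimum (lower z))

    z/y∙y⊑z : (z / y ∙ y) ⊑ z
    z/y∙y⊑z = argmax-all ℤ.≤-totalOrder v {P = λ i → (lift i ∙ y) ⊑ z} last∙y⊑z
                (all-filter (λ i → v (lower (lift i ∙ y)) ℤ.≤? v (lower z)) (allFin n))

  -- Translates between the order of heights and the order of `ResiduatedLattice`, which is defined
  -- through the meet.
  ⊑⇔≈⊓ : ∀ x y → x ⊑ y ⇔ x ≈ x ⊓ y
  ⊑⇔≈⊓ x y = mk⇔ (λ p → lift (sym (lower (Meet.x≤y⇒x⊓y≈x {x} {y} p))))
                  (λ p → Meet.x⊓y≈x⇒x≤y {x} {y} (lift (sym (lower p))))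

  ∙-comm-⊑ : ∀ x y z → (x ∙ y) ⊑ z → (y ∙ x) ⊑ z
  ∙-comm-⊑ x y z = subst (_≼ lower z) (lower (∙-comm x y))

  residuatedLattice : ResiduatedLattice c ℓ
  residuatedLattice = record
    { Carrier   = Carrier
    ; _≈_       = _≈_
    ; _∧_       = _⊓_
    ; _∨_       = _⊔_
    ; _∙_       = _∙_
    ; _\\_      = λ x z → z / x
    ; _//_      = _/_
    ; e         = lift zero
    ; isLattice = ⊔-⊓-isLattice
    -- Index 0 is least in the index order, hence neutral for its maximum.
    ; isMonoid  = Product.⊔-isMonoid λ _ → z≤n
    ; \\-residual = λ x y z → mk⇔
        (λ p → to (⊑⇔≈⊓ (x ∙ y) z) (∙-comm-⊑ y x z
                 (from (/-residual y x z) (from (⊑⇔≈⊓ y (z / x)) p))))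
        (λ p → to (⊑⇔≈⊓ y (z / x)) (to (/-residual y x z)
                 (∙-comm-⊑ x y z (from (⊑⇔≈⊓ (x ∙ y) z) p))))
    ; //-residual = λ x y z → mk⇔
        (λ p → to (⊑⇔≈⊓ x (z / y)) (to (/-residual x y z) (from (⊑⇔≈⊓ (x ∙ y) z) p)))
        (λ p → to (⊑⇔≈⊓ (x ∙ y) z) (from (/-residual x y z) (from (⊑⇔≈⊓ x (z / y)) p)))
    }

  chain : CommutativeIdempotentResiduatedChain c ℓ n
  chain = record
    { residuatedLattice = residuatedLattice
    ; ∙-comm  = ∙-comm
    ; ∙-idem  = Product.⊔-idem
    ; ≤-total = λ x y → map (to (⊑⇔≈⊓ x y)) (to (⊑⇔≈⊓ y x))
                            (ℤ.≤-total (v (lower x)) (v (lower y)))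
    ; size    = lift , lower , λ y → lower y , lift
    }

-- The product of an arbitrary commutative idempotent residuated chain.

module _ {c ℓ n} (A : CommutativeIdempotentResiduatedChain c ℓ n) where
  open CommutativeIdempotentResiduatedChain A renaming (_≤_ to _⊑_)
  open OrderLattice (LatticeProperties.∨-∧-orderTheoreticLattice lattice)
    using (antisym; reflexive; module Eq) renaming (refl to ⊑-refl; trans to ⊑-trans)
  open IsMonoid isMonoid using (∙-cong; assoc; identityʳ; isSemigroup)

  private
    ∙-congʳ : ∀ {x y z} → x ≈ y → x ∙ z ≈ y ∙ z
    ∙-congʳ x≈y = ∙-cong x≈y Eq.refl

    ∙-congˡ : ∀ {x y z} → y ≈ z → x ∙ y ≈ x ∙ z
    ∙-congˡ y≈z = ∙-cong Eq.refl y≈z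

    resp : ∀ {x x′ y y′} → x ≈ x′ → y ≈ y′ → x ⊑ y → x′ ⊑ y′
    resp x≈x′ y≈y′ x⊑y = ⊑-trans (reflexive (Eq.sym x≈x′)) (⊑-trans x⊑y (reflexive y≈y′))

  -- By residuation `z` lies below the residual of `x ∙ z` by `x`; hence so does `y`.
  ∙-monoʳ : ∀ x {y z} → y ⊑ z → x ∙ y ⊑ x ∙ z
  ∙-monoʳ x {y} {z} y⊑z = to (\\-residual x y (x ∙ z))
    (⊑-trans y⊑z (from (\\-residual x z (x ∙ z)) ⊑-refl))

  -- If x ∙ y ⊑ e, multiplying by x gives x ∙ y ⊑ x; if e ⊑ x ∙ y, multiplying by y
  -- gives y ⊑ x ∙ y.
  ∙-selective-⊑ : ∀ {x y} → x ⊑ y → x ∙ y ≈ x ⊎ x ∙ y ≈ y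
  ∙-selective-⊑ {x} {y} x⊑y = map
    (λ xy⊑e → antisym (resp x∙xy≈xy (identityʳ x) (∙-monoʳ x xy⊑e))
                      (resp (∙-idem x) Eq.refl (∙-monoʳ x x⊑y)))
    (λ e⊑xy → antisym (resp (∙-comm y x) (∙-idem y) (∙-monoʳ y x⊑y))
                      (resp (identityʳ y) y∙xy≈xy (∙-monoʳ y e⊑xy)))
    (≤-total (x ∙ y) e)
    where
    x∙xy≈xy : ∀ {x y} → x ∙ (x ∙ y) ≈ x ∙ y
    x∙xy≈xy {x} {y} = Eq.trans (Eq.sym (assoc x x y)) (∙-congʳ (∙-idem x))

    y∙xy≈xy : y ∙ (x ∙ y) ≈ x ∙ y
    y∙xy≈xy = Eq.trans (∙-congˡ (∙-comm x y)) (Eq.trans x∙xy≈xy (∙-comm y x))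

  ∙-selective : Selective _≈_ _∙_
  ∙-selective x y = [ ∙-selective-⊑
                    , (λ y⊑x → map (Eq.trans (∙-comm x y)) (Eq.trans (∙-comm x y))
                                 (swap (∙-selective-⊑ y⊑x)))
                    ]′ (≤-total x y)

  ∙-isSemilattice : IsSemilattice _≈_ _∙_
  ∙-isSemilattice = record
    { isBand = record { isSemigroup = isSemigroup ; idem = ∙-idem }
    ; comm   = ∙-comm
    }

  -- z ≈ z ∙ (z \\ x) ⊑ x.
  absorbing⇒minimum : ∀ {z} → (∀ x → z ∙ x ≈ z) → ∀ x → z ⊑ x
  absorbing⇒minimum {z} absorbs x =
    resp (absorbs (z \\ x)) Eq.refl (to (\\-residual z (z \\ x) x) ⊑-refl)

  -- NaturalOrder puts e on top; the flip puts it first.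
  productOrder : TotalOrder c ℓ ℓ
  productOrder = Flip.totalOrder (NaturalOrder.totalOrder _≈_ _∙_ ∙-isSemilattice ∙-selective)

  -- Abstract, lest goals about the sorted elements unfold the sorting itself.
  abstract
    enumeration : ∃[ g ] Injective {A = Fin n} _≡_ _≈_ g × StrictlySurjective _≈_ g ×
                         (∀ i j → i Fin.≤ j → g i ∙ g j ≈ g j)
    enumeration with size
    ... | f , f-injective , f-surjective with sort productOrder f
    ...   | π , π-injective , π-surjective , π-monotone =
      f ∘ π
      , π-injective ∘ f-injective
      , (λ y → let x , eq = f-surjective y ; i , πi≡x = π-surjective x in i , eq πi≡x)
      , λ i j i≤j → Eq.sym (π-monotone i j i≤j)

-- Isomorphic word chains have equal words.

module _ {c ℓ : Level} {m : ℕ} {w₁ w₂ : Fin m → Fin 2} where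
  private
    module M₁ = WordChain c ℓ w₁
    module M₂ = WordChain c ℓ w₂

    v₁ v₂ : Fin (ℕ.suc (ℕ.suc m)) → ℤ
    v₁ = valuation w₁
    v₂ = valuation w₂

  -- The product determines the index order, so an isomorphism is strictly monotone on indices and
  -- therefore fixes each of them. Its compatibility with the lattice order then compares the two
  -- heights index by index.
  isomorphic⇒≤-⇔ : WordChain.chain c ℓ w₁ ≅ WordChain.chain c ℓ w₂ →
                   ∀ i j → v₁ i ℤ.≤ v₁ j ⇔ v₂ i ℤ.≤ v₂ j
  isomorphic⇒≤-⇔ I i j = mk⇔
    (λ p → subst₂ (λ x y → v₂ x ℤ.≤ v₂ y) (f≡id i) (f≡id j)
             (from (M₂.⊑⇔≈⊓ ⟦ lift i ⟧ ⟦ lift j ⟧)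
               (to order (to (M₁.⊑⇔≈⊓ (lift i) (lift j)) p))))
    (λ p → from (M₁.⊑⇔≈⊓ (lift i) (lift j)) (from order
             (to (M₂.⊑⇔≈⊓ ⟦ lift i ⟧ ⟦ lift j ⟧)
               (subst₂ (λ x y → v₂ x ℤ.≤ v₂ y) (sym (f≡id i)) (sym (f≡id j)) p))))
    where
    open Isomorphism I
    module R₁ = ResiduatedLattice M₁.residuatedLattice
    module R₂ = ResiduatedLattice M₂.residuatedLattice
    open LatticeMorphisms R₁.rawLattice R₂.rawLattice using (module IsLatticeIsomorphism)
    open MonoidMorphisms R₁.rawMonoid R₂.rawMonoid using (module IsMonoidHomomorphism)
    open IsLatticeIsomorphism isLatticeIsomorphism using (⟦⟧-cong; injective)
    open IsMonoidHomomorphism isMonoidHomomorphism using (homo)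

    order : ∀ {x y} → x R₁.≤ y ⇔ ⟦ x ⟧ R₂.≤ ⟦ y ⟧
    order {x} {y} = isomorphism-≤ M₁.residuatedLattice M₂.residuatedLattice I {x} {y}

    f : Fin (ℕ.suc (ℕ.suc m)) → Fin (ℕ.suc (ℕ.suc m))
    f i = lower ⟦ lift i ⟧

    f-mono : ∀ {i j} → i Fin.≤ j → f i Fin.≤ f j
    f-mono {i} {j} i≤j = M₂.x∙y≡y⇒x≤y ⟦ lift i ⟧ ⟦ lift j ⟧ (trans
      (sym (lower (homo (lift i) (lift j))))
      (lower (⟦⟧-cong (lift (M₁.x≤y⇒x∙y≡y (lift i) (lift j) i≤j)))))

    f≡id : ∀ i → f i ≡ i
    f≡id = strictlyMonotone⇒id f λ i<j → Fin.≤∧≢⇒< (f-mono (ℕ.<⇒≤ i<j))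
      λ fi≡fj → Fin.<⇒≢ i<j (lower (injective (lift fi≡fj)))

  wordChain-injective : WordChain.chain c ℓ w₁ ≅ WordChain.chain c ℓ w₂ → w₁ ≗ w₂
  wordChain-injective I i = begin
    w₁ i                                           ≡⟨ insertAt-punchIn w₁ (fromℕ m) 0F i ⟨
    -- Comparison with the unit, at height 0, reveals the sign; `punchIn (fromℕ m)` skips the
    -- appended last position.
    insertAt w₁ (fromℕ m) 0F (punchIn (fromℕ m) i) ≡⟨ value-suc-injective
      (isomorphic⇒≤-⇔ I (suc (punchIn (fromℕ m) i)) zero) ⟩
    insertAt w₂ (fromℕ m) 0F (punchIn (fromℕ m) i) ≡⟨ insertAt-punchIn w₂ (fromℕ m) 0F i ⟩
    w₂ i                                           ∎
    where open ≡-Reasoning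

-- Every chain is isomorphic to the chain of a word.

module _ {c ℓ m} (A : CommutativeIdempotentResiduatedChain c ℓ (ℕ.suc (ℕ.suc m))) where
  open CommutativeIdempotentResiduatedChain A renaming (_≤_ to _⊑_)
  open OrderLattice (LatticeProperties.∨-∧-orderTheoreticLattice lattice)
    using (antisym; reflexive; module Eq) renaming (refl to ⊑-refl; trans to ⊑-trans)
  open IsMonoid isMonoid using (identityʳ; ∙-cong)

  enum : Fin (ℕ.suc (ℕ.suc m)) → Carrier
  enum = proj₁ (enumeration A)

  private
    enum-injective  = proj₁ (proj₂ (enumeration A))
    enum-surjective = proj₁ (proj₂ (proj₂ (enumeration A)))

    enum-∙ : ∀ i j → i Fin.≤ j → enum i ∙ enum j ≈ enum j
    enum-∙ = proj₂ (proj₂ (proj₂ (enumeration A)))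

    enum-∙′ : ∀ i j → j Fin.≤ i → enum i ∙ enum j ≈ enum i
    enum-∙′ i j j≤i = Eq.trans (∙-comm (enum i) (enum j)) (enum-∙ j i j≤i)

  -- The first element is absorbed by every element, in particular by `e`, and `x ∙ e ≈ e` means
  -- `x ≈ e`.
  first≈e : enum zero ≈ e
  first≈e with enum-surjective e
  ... | i , gi≈e = begin
    enum zero          ≈⟨ identityʳ (enum zero) ⟨
    enum zero ∙ e      ≈⟨ ∙-cong Eq.refl gi≈e ⟨
    enum zero ∙ enum i ≈⟨ enum-∙ zero i z≤n ⟩
    enum i             ≈⟨ gi≈e ⟩
    e                  ∎
    where open SetoidReasoning (Lattice.setoid lattice)

  last⊑ : ∀ x → enum (fromℕ (ℕ.suc m)) ⊑ x
  last⊑ = absorbing⇒minimum A λ x → let i , gi≈x = enum-surjective x in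
    Eq.trans (∙-cong Eq.refl (Eq.sym gi≈x)) (enum-∙′ (fromℕ (ℕ.suc m)) i (Fin.≤fromℕ i))

  module _ (w : Fin m → Fin 2) where
    private
      module M = WordChain c ℓ w

      v : Fin (ℕ.suc (ℕ.suc m)) → ℤ
      v = valuation w

    -- Elements on opposite sides of `e` are compared through `e`. On the same side, the comparison
    -- of one element with `e` is multiplied by the other, and the product is the element of larger
    -- index. Order reflection follows from monotonicity, injectivity of `enum` and totality of the
    -- heights.
    model-isomorphic : (∀ i → v i ℤ.≤ 0ℤ → enum i ⊑ e) →
                       (∀ i → 0ℤ ℤ.≤ v i → e ⊑ enum i) → WordChain.chain c ℓ w ≅ A
    model-isomorphic nonPos nonNeg =
      orderIsomorphism M.residuatedLattice residuatedLattice (enum ∘ lower)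
        (λ {x} {y} → mk⇔ (enum-mono ∘ from (M.⊑⇔≈⊓ x y)) (to (M.⊑⇔≈⊓ x y) ∘ enum-cancel))
        (λ y → let i , gi≈y = enum-surjective y in lift i , gi≈y)
        ∙-homo first≈e
      where
      enum-mono : ∀ {i j} → v i ℤ.≤ v j → enum i ⊑ enum j
      enum-mono {i} {j} vi≤vj with ℤ.≤-total (v i) 0ℤ | ℤ.≤-total 0ℤ (v j)
      ... | inj₁ vi≤0 | inj₁ 0≤vj = ⊑-trans (nonPos i vi≤0) (nonNeg j 0≤vj)
      ... | inj₁ vi≤0 | inj₂ vj≤0 = begin
        enum i          ≈⟨ enum-∙ j i (M.≼⇒≥-nonPos vj≤0 vi≤vj) ⟨
        enum j ∙ enum i ≤⟨ ∙-monoʳ A (enum j) (nonPos i vi≤0) ⟩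
        enum j ∙ e      ≈⟨ identityʳ (enum j) ⟩
        enum j          ∎
        where open PosetReasoning (LatticeProperties.poset lattice)
      ... | inj₂ 0≤vi | _ = begin
        enum i          ≈⟨ identityʳ (enum i) ⟨
        enum i ∙ e      ≤⟨ ∙-monoʳ A (enum i) (nonNeg j (ℤ.≤-trans 0≤vi vi≤vj)) ⟩
        enum i ∙ enum j ≈⟨ enum-∙ i j (M.≼⇒≤-nonNeg 0≤vi vi≤vj) ⟩
        enum j          ∎
        where open PosetReasoning (LatticeProperties.poset lattice)

      enum-cancel : ∀ {i j} → enum i ⊑ enum j → v i ℤ.≤ v j
      enum-cancel {i} {j} gi⊑gj with ℤ.≤-total (v i) (v j)
      ... | inj₁ vi≤vj = vi≤vj
      ... | inj₂ vj≤vi = ℤ.≤-reflexive (cong v (enum-injective (antisym gi⊑gj (enum-mono vj≤vi))))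

      ∙-homo : ∀ x y → enum (lower (x M.Product.⊔ y)) ≈ enum (lower x) ∙ enum (lower y)
      ∙-homo x y with Fin.≤-total (lower x) (lower y)
      ... | inj₁ x≤y = Eq.trans
        (Eq.reflexive (cong enum (M.x≤y⇒x∙y≡y x y x≤y))) (Eq.sym (enum-∙ _ _ x≤y))
      ... | inj₂ y≤x = Eq.trans
        (Eq.reflexive (cong enum (M.x≥y⇒x∙y≡x x y y≤x))) (Eq.sym (enum-∙′ _ _ y≤x))

  private
    inner : Fin m → Carrier
    inner j = enum (suc (punchIn (fromℕ m) j))

    -- A sign is kept together with the comparison that justifies it, so that both survive rewriting
    -- along the equations for `insertAt`.
    IsSign : Fin 2 → Carrier → Set ℓ
    IsSign s x = s ≡ 0F × x ⊑ e ⊎ s ≡ 1F × e ⊑ x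

    ≤0⇒⊑e : ∀ {s x} k → IsSign s x → value s (ℕ.suc k) ℤ.≤ 0ℤ → x ⊑ e
    ≤0⇒⊑e k (inj₁ (refl , x⊑e)) _           = x⊑e
    ≤0⇒⊑e k (inj₂ (refl , _))   (ℤ.+≤+ ())

    0≤⇒e⊑ : ∀ {s x} k → IsSign s x → 0ℤ ℤ.≤ value s (ℕ.suc k) → e ⊑ x
    0≤⇒e⊑ k (inj₁ (refl , _))   ()
    0≤⇒e⊑ k (inj₂ (refl , e⊑x)) _ = e⊑x

  word : Fin m → Fin 2
  word j = [ (λ _ → 0F) , (λ _ → 1F) ]′ (≤-total (inner j) e)

  word-isSign : ∀ j → IsSign (word j) (inner j)
  word-isSign j with ≤-total (inner j) e
  ... | inj₁ x⊑e = inj₁ (refl , x⊑e)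
  ... | inj₂ e⊑x = inj₂ (refl , e⊑x)

  -- Pointwise agreement with `word` is assumed because encoding a word in `Fin` and decoding it
  -- again returns a function known to be equal only pointwise.
  wordChain-surjective : (w : Fin m → Fin 2) → w ≗ word → WordChain.chain c ℓ w ≅ A
  wordChain-surjective w w≗word = model-isomorphic w
    (λ { zero    _ → reflexive first≈e ; (suc i) → ≤0⇒⊑e (toℕ i) (isSign i) })
    (λ { zero    _ → reflexive (Eq.sym first≈e) ; (suc i) → 0≤⇒e⊑ (toℕ i) (isSign i) })
    where
    isSign : ∀ i → IsSign (insertAt w (fromℕ m) 0F i) (enum (suc i))
    isSign i with fromℕ m Fin.≟ i
    -- The last position has the appended sign `0F`, which is right because the last element is the
    -- minimum of the chain.
    ... | yes refl   = inj₁ (insertAt-lookup w (fromℕ m) 0F , last⊑ e)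
    ... | no  last≢i = subst (λ i → IsSign (insertAt w (fromℕ m) 0F i) (enum (suc i)))
      (Fin.punchIn-punchOut last≢i)
      (subst (λ s → IsSign s (inner j))
        (sym (trans (insertAt-punchIn w (fromℕ m) 0F j) (w≗word j))) (word-isSign j))
      where j = punchOut last≢i

-- Counting the words.

funToFin-cong : ∀ {m n} {f g : Fin m → Fin n} → f ≗ g → funToFin f ≡ funToFin g
funToFin-cong {ℕ.zero}  f≗g = refl
funToFin-cong {ℕ.suc m} f≗g = cong₂ Fin.combine (f≗g zero) (funToFin-cong (f≗g ∘ suc))

theorem3p2 : (c ℓ : Level) (n : ℕ) → 2 ≤ n →
    HasExactly (2 ^ (n ∸ 2)) (_≅_ {c} {ℓ} {n})
-- The pattern writes the size as `m` plus 2; `finToFun` decodes the `2 ^ m` indices as the words of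
-- length `m`.
theorem3p2 c ℓ _ (s≤s (s≤s {n = m} z≤n)) = (λ k → WordChain.chain c ℓ (finToFun k))
  , (λ {k} {l} I → begin
      k                         ≡⟨ Fin.funToFin-finToFin {m} k ⟨
      funToFin {m} (finToFun k) ≡⟨ funToFin-cong (wordChain-injective I) ⟩
      funToFin {m} (finToFun l) ≡⟨ Fin.funToFin-finToFin {m} l ⟩
      l                         ∎)
  , λ A → funToFin (word A) ,
      λ { refl → wordChain-surjective A _ (Fin.finToFun-funToFin (word A)) }
  where open ≡-Reasoning
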